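{- For every prime power $q$ there exists a $(9,2)$-set $X_q$ in $\mathrm{PG}(4,q)$ with $|X_q| = (1+o(1))\, q^2$ as $q \to \infty$.
   Context: $\mathrm{PG}(4,q)$ is the projective space whose points are the $1$-dimensional subspaces of $\mathbb{F}_q^{5}$; a plane is a $3$-dimensional vector subspace. A $(9,2)$-set is a set of points such that every plane contains at most $9$ of its points. -}

module Defs where

open import Level using (0ℓ)
open import Data.Nat using (ℕ; _≤_; _*_; _^_)
open import Data.Fin using (Fin)
open import Data.Product using (Σ; ∃; _×_)
open import Relation.Nullary using (¬_)
open import Relation.Binary.PropositionalEquality using (_≡_)
open import Algebra.Structures using (IsCommutativeRing)
open import Function.Bundles using (_↔_)

-- A finite field of order q (with propositional equality on the carrier).
-- Every finite field has prime-power order and every prime power occurs,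
-- so quantifying over these records is quantifying over the fields F_q.
record FiniteField (q : ℕ) : Set₁ where
  infixl 7 _·_
  infixl 6 _⊕_
  field
    Carrier : Set
    _⊕_ _·_ : Carrier → Carrier → Carrier
    ⊖_ : Carrier → Carrier
    𝟘 𝟙 : Carrier
    isCommutativeRing : IsCommutativeRing _≡_ _⊕_ _·_ ⊖_ 𝟘 𝟙
    𝟘≢𝟙 : ¬ (𝟘 ≡ 𝟙)
    inverse : ∀ x → ¬ (x ≡ 𝟘) → Σ Carrier (λ y → x · y ≡ 𝟙)
    enumeration : Fin q ↔ Carrier

module PG4 {q : ℕ} (F : FiniteField q) where
  open FiniteField F

  V : Set
  V = Fin 5 → Carrier

  NonZero : V → Set
  NonZero x = ¬ (∀ i → x i ≡ 𝟘)

  -- x and y span the same 1-dimensional subspace (for nonzero x, y)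
  SamePoint : V → V → Set
  SamePoint x y = Σ Carrier (λ c → ∀ i → x i ≡ c · y i)

  -- u, v, w linearly independent (so their span is a plane)
  Independent : V → V → V → Set
  Independent u v w = ∀ a b c → (∀ i → a · u i ⊕ b · v i ⊕ c · w i ≡ 𝟘)
                      → (a ≡ 𝟘) × (b ≡ 𝟘) × (c ≡ 𝟘)

  InSpan : V → V → V → V → Set
  InSpan u v w x = Σ Carrier λ a → Σ Carrier λ b → Σ Carrier λ c →
                   ∀ i → x i ≡ a · u i ⊕ b · v i ⊕ c · w i

  -- a set of n points of PG(4,q): n nonzero vectors representing
  -- pairwise distinct 1-dimensional subspaces
  record PointSet (n : ℕ) : Set where
    field
      pt : Fin n → V
      nonzero : ∀ i → NonZero (pt i)
      distinct : ∀ i j → SamePoint (pt i) (pt j) → i ≡ j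

  Is92Set : ∀ {n} → PointSet n → Set
  Is92Set {n} X = ∀ u v w → Independent u v w →
    ¬ (Σ (Fin 10 → Fin n) λ f →
         (∀ i j → f i ≡ f j → i ≡ j) × (∀ i → InSpan u v w (PointSet.pt X (f i))))

{-# OPTIONS --safe #-}
-- X_q is the surface of all points (1 : x : y : f : g) with f = x³ + y² and
-- g = x⁴ + y³; it has exactly q² points.  A plane imposes two independent linear
-- relations on 1, x, y, f, g.  If some relation involves only 1, x, y, then (x , y)
-- lies on a line, where a second relation is a nonzero polynomial of degree at
-- most 4.  Otherwise f = a + b x + c y and g = a′ + b′ x + c′ y.  The first equation
-- is the cubic curve y² = P(x) + c y with P = a + b x − x³; reducing the second
-- modulo it gives A(x) y = B(x) with A, B monic of degrees 3 and 4.  The norm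
-- P A² + c A B − B² has degree exactly 9 in every characteristic, and x is a root
-- of it, counted twice whenever A(x) = B(x) = 0, hence at most 9 points.
module Submission where

open import Defs
open import Level using (0ℓ)
open import Algebra.Bundles using (CommutativeRing; RawRing)
open import Data.Nat using (ℕ; zero; suc; _≤_; _<_; _*_; _^_; _+_; z≤n; s≤s; _≤′_; ≤′-refl; ≤′-step)
import Data.Nat.Properties as ℕ
open import Data.Product using (Σ; _×_; _,_; proj₁; proj₂; uncurry)
open import Data.Fin using (Fin; remQuot; combine)
open import Data.Fin.Patterns using (0F; 1F; 2F; 3F; 4F)
import Data.Fin.Properties as Fin
open import Data.Vec using (Vec; []; _∷_; map)
open import Data.Vec.Relation.Unary.Any using (Any; here; there)
import Data.Vec.Relation.Unary.All as VecAll
open import Data.List as List using (List; []; _∷_; length; filter)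
import Data.List.Properties as List
open import Data.List.Relation.Unary.All as All using (All; []; _∷_)
import Data.List.Relation.Unary.All.Properties as All
import Data.List.Relation.Unary.Any as ListAny
open import Data.List.Relation.Unary.AllPairs using ([]; _∷_)
open import Data.List.Relation.Unary.Unique.Propositional using (Unique)
import Data.List.Relation.Unary.Unique.Propositional.Properties as Unique
open import Data.Maybe using (just; nothing)
open import Data.Empty using (⊥-elim)
open import Function using (_∘_; _$_)
open import Function.Bundles using (Inverse; Injection)
open import Function.Properties.Inverse using (↔-sym; Inverse⇒Injection)
open import Relation.Nullary using (Dec; yes; no)
open import Relation.Nullary.Decidable using (via-injection; ¬?)
open import Relation.Unary using (Decidable)
open import Relation.Binary.PropositionalEquality using (_≡_; _≢_; refl; sym; trans; cong; cong₂; subst; subst₂; module ≡-Reasoning)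

-- A ring solver with integer coefficients, valid in every commutative ring.

module IntegerCoefficientSolver (R : CommutativeRing 0ℓ 0ℓ) where
  open CommutativeRing R hiding (zero) renaming (_+_ to _⊕_; _*_ to _·_; refl to ≈-refl; sym to ≈-sym; trans to ≈-trans)
  open import Algebra.Properties.Semiring.Mult.TCOptimised semiring using (×-homo-+; ×1-homo-*) renaming (_×_ to _×′_)
  open import Algebra.Properties.Ring ring using (-1*x≈-x; -‿involutive)
  open import Algebra.Solver.Ring.AlmostCommutativeRing using (fromCommutativeRing; _-Raw-AlmostCommutative⟶_; Induced-equivalence)
  open import Algebra.Solver.Ring.NaturalCoefficients.Default commutativeSemiring as N using (_:+_; _:*_; _:=_)
  open import Relation.Binary.Reasoning.Setoid setoid
  open import Relation.Binary.Definitions using (WeaklyDecidable)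

  -- (a , b) stands for a − b.
  differences : RawRing 0ℓ 0ℓ
  differences = record
    { Carrier = ℕ × ℕ
    ; _≈_ = _≡_
    ; _+_ = λ (a , b) (c , d) → a + c , b + d
    ; _*_ = λ (a , b) (c , d) → a * c + b * d , a * d + b * c
    ; -_ = λ (a , b) → b , a
    ; 0# = 0 , 0
    ; 1# = 1 , 0
    }

  private
    ι : ℕ → Carrier
    ι n = n ×′ 1#

    -- The clause for b = 0 makes the coefficients 0 and 1 denote 0# and 1# definitionally.
    ⟦_⟧ : ℕ × ℕ → Carrier
    ⟦ a , zero ⟧ = ι a
    ⟦ a , suc b ⟧ = ι a ⊕ (- 1#) · ι (suc b)

    ⟦⟧-spec : ∀ a b → ⟦ a , b ⟧ ≈ ι a ⊕ (- 1#) · ι b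
    ⟦⟧-spec a zero = ≈-sym (≈-trans (+-congˡ (zeroʳ _)) (+-identityʳ _))
    ⟦⟧-spec a (suc b) = ≈-refl

    -1·-1 : (- 1#) · (- 1#) ≈ 1#
    -1·-1 = ≈-trans (-1*x≈-x _) (-‿involutive 1#)

    1-1 : 1# ⊕ (- 1#) ≈ 0#
    1-1 = -‿inverseʳ 1#

    ι-+ : ∀ m n → ι (m + n) ≈ ι m ⊕ ι n
    ι-+ = ×-homo-+ 1#

    ι-* : ∀ m n → ι (m * n) ≈ ι m · ι n
    ι-* = ×1-homo-*

    +-homo : ∀ s t → ⟦ RawRing._+_ differences s t ⟧ ≈ ⟦ s ⟧ ⊕ ⟦ t ⟧
    +-homo (a , b) (c , d) = begin
      ⟦ a + c , b + d ⟧                               ≈⟨ ⟦⟧-spec (a + c) (b + d) ⟩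
      ι (a + c) ⊕ (- 1#) · ι (b + d)                  ≈⟨ +-cong (ι-+ a c) (*-congˡ (ι-+ b d)) ⟩
      (ι a ⊕ ι c) ⊕ (- 1#) · (ι b ⊕ ι d)              ≈⟨ N.solve 5 (λ a b c d n → (a :+ c) :+ n :* (b :+ d) := (a :+ n :* b) :+ (c :+ n :* d)) ≈-refl (ι a) (ι b) (ι c) (ι d) (- 1#) ⟩
      (ι a ⊕ (- 1#) · ι b) ⊕ (ι c ⊕ (- 1#) · ι d)     ≈⟨ +-cong (⟦⟧-spec a b) (⟦⟧-spec c d) ⟨
      ⟦ a , b ⟧ ⊕ ⟦ c , d ⟧                           ∎

    *-homo : ∀ s t → ⟦ RawRing._*_ differences s t ⟧ ≈ ⟦ s ⟧ · ⟦ t ⟧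
    *-homo (a , b) (c , d) = begin
      ⟦ a * c + b * d , a * d + b * c ⟧               ≈⟨ ⟦⟧-spec (a * c + b * d) (a * d + b * c) ⟩
      ι (a * c + b * d) ⊕ (- 1#) · ι (a * d + b * c)  ≈⟨ +-cong (ι-+* a c b d) (*-congˡ (ι-+* a d b c)) ⟩
      (ι a · ι c ⊕ ι b · ι d) ⊕ (- 1#) · (ι a · ι d ⊕ ι b · ι c)
        ≈⟨ +-congʳ (+-congˡ (≈-trans (*-congʳ -1·-1) (*-identityˡ _))) ⟨
      (ι a · ι c ⊕ ((- 1#) · (- 1#)) · (ι b · ι d)) ⊕ (- 1#) · (ι a · ι d ⊕ ι b · ι c)
        ≈⟨ N.solve 5 (λ a b c d n → (a :* c :+ (n :* n) :* (b :* d)) :+ n :* (a :* d :+ b :* c) := (a :+ n :* b) :* (c :+ n :* d)) ≈-refl (ι a) (ι b) (ι c) (ι d) (- 1#) ⟩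
      (ι a ⊕ (- 1#) · ι b) · (ι c ⊕ (- 1#) · ι d)     ≈⟨ *-cong (⟦⟧-spec a b) (⟦⟧-spec c d) ⟨
      ⟦ a , b ⟧ · ⟦ c , d ⟧                           ∎
      where
      ι-+* : ∀ a b c d → ι (a * b + c * d) ≈ ι a · ι b ⊕ ι c · ι d
      ι-+* a b c d = ≈-trans (ι-+ (a * b) (c * d)) (+-cong (ι-* a b) (ι-* c d))

    -‿homo : ∀ s → ⟦ RawRing.-_ differences s ⟧ ≈ - ⟦ s ⟧
    -‿homo (a , b) = begin
      ⟦ b , a ⟧                              ≈⟨ ⟦⟧-spec b a ⟩
      ι b ⊕ (- 1#) · ι a                     ≈⟨ +-congʳ (≈-trans (*-congʳ -1·-1) (*-identityˡ _)) ⟨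
      ((- 1#) · (- 1#)) · ι b ⊕ (- 1#) · ι a ≈⟨ N.solve 3 (λ a b n → (n :* n) :* b :+ n :* a := n :* (a :+ n :* b)) ≈-refl (ι a) (ι b) (- 1#) ⟩
      (- 1#) · (ι a ⊕ (- 1#) · ι b)          ≈⟨ -1*x≈-x _ ⟩
      - (ι a ⊕ (- 1#) · ι b)                 ≈⟨ -‿cong (⟦⟧-spec a b) ⟨
      - ⟦ a , b ⟧                            ∎

    morphism : differences -Raw-AlmostCommutative⟶ fromCommutativeRing R
    morphism = record
      { ⟦_⟧ = ⟦_⟧ ; +-homo = +-homo ; *-homo = *-homo ; -‿homo = -‿homo
      ; 0-homo = ≈-refl ; 1-homo = ≈-refl }

    -- Different pairs can denote the same integer, so differences are compared through the cross
    -- sums `a + d` and `c + b`. If these differ, nothing is claimed: the images in `R` may still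
    -- agree in positive characteristic.
    equal? : WeaklyDecidable (Induced-equivalence morphism)
    equal? (a , b) (c , d) with a + d ℕ.≟ c + b
    ... | no _ = nothing
    ... | yes a+d≡c+b = just (begin
      ⟦ a , b ⟧                                         ≈⟨ ⟦⟧-spec a b ⟩
      -- Adding `ι d - ι d` makes the sum `a + d` appear, to which the hypothesis applies; the same
      -- with `ι b` is undone at the end.
      ι a ⊕ (- 1#) · ι b                                ≈⟨ pad (ι d) _ ⟩
      (1# ⊕ (- 1#)) · ι d ⊕ (ι a ⊕ (- 1#) · ι b)        ≈⟨ N.solve 5 (λ a b d n e → (e :+ n) :* d :+ (a :+ n :* b) := (a :+ e :* d) :+ n :* (b :+ d)) ≈-refl (ι a) (ι b) (ι d) (- 1#) 1# ⟩
      (ι a ⊕ 1# · ι d) ⊕ (- 1#) · (ι b ⊕ ι d)           ≈⟨ +-congʳ a+d≈c+b ⟩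
      (ι c ⊕ 1# · ι b) ⊕ (- 1#) · (ι b ⊕ ι d)           ≈⟨ N.solve 5 (λ b c d n e → (c :+ e :* b) :+ n :* (b :+ d) := (e :+ n) :* b :+ (c :+ n :* d)) ≈-refl (ι b) (ι c) (ι d) (- 1#) 1# ⟩
      (1# ⊕ (- 1#)) · ι b ⊕ (ι c ⊕ (- 1#) · ι d)        ≈⟨ pad (ι b) _ ⟨
      ι c ⊕ (- 1#) · ι d                                ≈⟨ ⟦⟧-spec c d ⟨
      ⟦ c , d ⟧                                         ∎)
      where
      pad : ∀ x y → y ≈ (1# ⊕ (- 1#)) · x ⊕ y
      pad x y = ≈-sym (≈-trans (+-congʳ (≈-trans (*-congʳ 1-1) (zeroˡ x))) (+-identityˡ y))
      a+d≈c+b : ι a ⊕ 1# · ι d ≈ ι c ⊕ 1# · ι b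
      a+d≈c+b = begin
        ι a ⊕ 1# · ι d  ≈⟨ +-congˡ (*-identityˡ _) ⟩
        ι a ⊕ ι d       ≈⟨ ι-+ a d ⟨
        ι (a + d)       ≡⟨ cong ι a+d≡c+b ⟩
        ι (c + b)       ≈⟨ ι-+ c b ⟩
        ι c ⊕ ι b       ≈⟨ +-congˡ (*-identityˡ _) ⟨
        ι c ⊕ 1# · ι b  ∎

  open import Algebra.Solver.Ring differences (fromCommutativeRing R) morphism equal? public
    using (solve; _:=_; _:+_; _:*_; _:-_; :-_; con; Polynomial)

  :0 :1 : ∀ {n} → Polynomial n
  :0 = con (0 , 0)
  :1 = con (1 , 0)

-- Lists without repetitions.

module _ {a} {A : Set a} where

  length-filter-split : ∀ {p} {P : A → Set p} (P? : Decidable P) (xs : List A) →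
    length xs ≡ length (filter P? xs) + length (filter (¬? ∘ P?) xs)
  length-filter-split P? [] = refl
  length-filter-split P? (x ∷ xs) with P? x
  ... | yes _ = cong suc (length-filter-split P? xs)
  ... | no _ = trans (cong suc (length-filter-split P? xs)) (sym (ℕ.+-suc _ _))

  -- Injectivity is asked only between elements satisfying `P`: the coordinate projections used
  -- below are injective only on a line, or where one coordinate determines the other.
  unique-map : ∀ {b p} {B : Set b} {P : A → Set p} (f : A → B) →
    (∀ {x y} → P x → P y → f x ≡ f y → x ≡ y) →
    ∀ {xs} → Unique xs → All P xs → Unique (List.map f xs)
  unique-map f inj [] [] = []
  unique-map f inj (x∉xs ∷ xs!) (px ∷ pxs) =
    All.map⁺ (All.zipWith (λ (x≢y , py) fx≡fy → x≢y (inj px py fx≡fy)) (x∉xs , pxs))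
    ∷ unique-map f inj xs! pxs

-- Arithmetic and geometry over a finite field.

module OverField {q : ℕ} (F : FiniteField q) where
  open FiniteField F

  commutativeRing : CommutativeRing 0ℓ 0ℓ
  commutativeRing = record { isCommutativeRing = isCommutativeRing }

  open CommutativeRing commutativeRing using (zeroˡ; zeroʳ; +-identityˡ; +-identityʳ; *-identityˡ; *-identityʳ; *-comm)
  open import Algebra.Properties.Ring (CommutativeRing.ring commutativeRing) using (x≈y⇒x∙y⁻¹≈ε; x∙y⁻¹≈ε⇒x≈y)
  open IntegerCoefficientSolver commutativeRing

  infix 4 _≟_
  _≟_ : (x y : Carrier) → Dec (x ≡ y)
  _≟_ = via-injection (Inverse⇒Injection (↔-sym enumeration)) Fin._≟_

  ·-cancel-0 : ∀ {x y} → x ≢ 𝟘 → x · y ≡ 𝟘 → y ≡ 𝟘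
  ·-cancel-0 {x} {y} x≢0 xy≡0 = let i , xi≡1 = inverse x x≢0 in begin
    y            ≡⟨ *-identityˡ y ⟨
    𝟙 · y        ≡⟨ cong (_· y) xi≡1 ⟨
    (x · i) · y  ≡⟨ solve 3 (λ x y i → (x :* i) :* y := i :* (x :* y)) refl x y i ⟩
    i · (x · y)  ≡⟨ cong (i ·_) xy≡0 ⟩
    i · 𝟘        ≡⟨ zeroʳ i ⟩
    𝟘            ∎
    where open ≡-Reasoning

  ·-nonzero : ∀ {x y} → x ≢ 𝟘 → y ≢ 𝟘 → x · y ≢ 𝟘
  ·-nonzero x≢0 y≢0 xy≡0 = y≢0 (·-cancel-0 x≢0 xy≡0)

  ·-cancelˡ : ∀ {x y z} → x ≢ 𝟘 → x · y ≡ x · z → y ≡ z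
  ·-cancelˡ {x} {y} {z} x≢0 xy≡xz = x∙y⁻¹≈ε⇒x≈y y z (·-cancel-0 x≢0
    (trans (solve 3 (λ x y z → x :* (y :- z) := x :* y :- x :* z) refl x y z) (x≈y⇒x∙y⁻¹≈ε xy≡xz)))

  drop-term : ∀ {b x t} → b ≡ 𝟘 → x · b ⊕ t ≡ 𝟘 → t ≡ 𝟘
  drop-term {x = x} {t} refl eq = trans (solve 2 (λ x t → t := x :* :0 :+ t) refl x t) eq

  -- Linear algebra

  dot : ∀ {n} → Vec Carrier n → Vec Carrier n → Carrier
  dot [] [] = 𝟘
  dot (x ∷ xs) (y ∷ ys) = x · y ⊕ dot xs ys

  Nontrivial : ∀ {n} → Vec Carrier n → Set
  Nontrivial = Any (_≢ 𝟘)

  axpy : ∀ {n} → Carrier → Vec Carrier n → Vec Carrier n → Vec Carrier n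
  axpy s [] [] = []
  axpy s (x ∷ xs) (y ∷ ys) = s · x ⊕ y ∷ axpy s xs ys

  dot-axpy : ∀ {n} s (u v w : Vec Carrier n) → dot (axpy s u v) w ≡ s · dot u w ⊕ dot v w
  dot-axpy s [] [] [] = solve 1 (λ s → :0 := s :* :0 :+ :0) refl s
  dot-axpy s (x ∷ u) (y ∷ v) (z ∷ w) = trans (cong ((s · x ⊕ y) · z ⊕_) (dot-axpy s u v w))
    (solve 6 (λ s x y z d e → (s :* x :+ y) :* z :+ (s :* d :+ e) := s :* (x :* z :+ d) :+ (y :* z :+ e)) refl s x y z (dot u w) (dot v w))

  -- `embed` parametrises vectors orthogonal to `u` by `n` free coordinates. Its adjoint `transpose`
  -- rewrites any further linear equation in these coordinates.
  record Hyperplane {n} (u : Vec Carrier (suc n)) : Set where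
    field
      embed : Vec Carrier n → Vec Carrier (suc n)
      transpose : Vec Carrier (suc n) → Vec Carrier n
      adjoint : ∀ v w → dot v (embed w) ≡ dot (transpose v) w
      annihilated : ∀ w → dot u (embed w) ≡ 𝟘
      injective : ∀ {w} → Nontrivial w → Nontrivial (embed w)

  hyperplane : ∀ {n} (u : Vec Carrier (suc n)) → Hyperplane u
  hyperplane (x ∷ u) with x ≟ 𝟘
  hyperplane (x ∷ u) | no x≢0 = record
    -- The leading coordinate is solved for in terms of the others, `i` being the inverse of `x`.
    { embed = λ w → (⊖ i) · dot u w ∷ w
    ; transpose = λ { (y ∷ v) → axpy (y · (⊖ i)) u v }
    ; adjoint = λ { (y ∷ v) w → trans
        (solve 4 (λ y j d e → y :* (j :* d) :+ e := y :* j :* d :+ e) refl y (⊖ i) (dot u w) (dot v w))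
        (sym (dot-axpy (y · (⊖ i)) u v w)) }
    ; annihilated = λ w → trans
        (solve 3 (λ x i d → x :* ((:- i) :* d) :+ d := (:1 :- x :* i) :* d) refl x i (dot u w))
        (trans (cong (λ t → (𝟙 ⊕ ⊖ t) · dot u w) xi≡1) (solve 1 (λ d → (:1 :- :1) :* d := :0) refl (dot u w)))
    ; injective = there
    }
    where
    i = proj₁ (inverse x x≢0)
    xi≡1 = proj₂ (inverse x x≢0)
  -- One coordinate must be given up although the equation is trivial; it is set to `𝟘`. An empty
  -- vector is never nontrivial, so `injective` is vacuous.
  hyperplane {zero} (x ∷ []) | yes x≡0 = record
    { embed = λ _ → 𝟘 ∷ []
    ; transpose = λ _ → []
    ; adjoint = λ { (y ∷ []) [] → solve 1 (λ y → y :* :0 :+ :0 := :0) refl y }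
    ; annihilated = λ _ → solve 1 (λ x → x :* :0 :+ :0 := :0) refl x
    ; injective = λ ()
    }
  hyperplane {suc n} (x ∷ u) | yes x≡0 = record
    { embed = λ { (z ∷ w) → z ∷ embed w }
    ; transpose = λ { (y ∷ v) → y ∷ transpose v }
    ; adjoint = λ { (y ∷ v) (z ∷ w) → cong (y · z ⊕_) (adjoint v w) }
    ; annihilated = λ { (z ∷ w) → trans (cong₂ (λ a b → a · z ⊕ b) x≡0 (annihilated w)) (solve 1 (λ z → :0 :* z :+ :0 := :0) refl z) }
    ; injective = λ { {_ ∷ _} (here z≢0) → here z≢0 ; {_ ∷ _} (there w≢0) → there (injective w≢0) }
    }
    where open Hyperplane (hyperplane u)

  -- Gaussian elimination: the first equation removes one unknown, and the remaining equations are
  -- transposed to the smaller space.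
  kernel : ∀ {m} (us : Vec (Vec Carrier (suc m)) m) →
    Σ (Vec Carrier (suc m)) λ w → Nontrivial w × VecAll.All (λ u → dot u w ≡ 𝟘) us
  kernel [] = 𝟙 ∷ [] , here (𝟘≢𝟙 ∘ sym) , VecAll.[]
  kernel (u ∷ us) =
    let w , w≢0 , us⊥w = kernel (map transpose us)
    in embed w , injective w≢0 , annihilated w VecAll.∷ pull us us⊥w
    where
    open Hyperplane (hyperplane u)
    pull : ∀ {k w} (vs : Vec _ k) → VecAll.All (λ v → dot v w ≡ 𝟘) (map transpose vs) →
           VecAll.All (λ v → dot v (embed w) ≡ 𝟘) vs
    pull [] VecAll.[] = VecAll.[]
    pull {w = w} (v ∷ vs) (v⊥w VecAll.∷ vs⊥w) = trans (adjoint v w) v⊥w VecAll.∷ pull vs vs⊥w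

  open PG4 F

  dot-span : ∀ {n} {u v w p : V} {a b c} → (∀ i → p i ≡ a · u i ⊕ b · v i ⊕ c · w i) →
    ∀ (is : Vec (Fin 5) n) β →
    dot (map p is) β ≡ a · dot (map u is) β ⊕ b · dot (map v is) β ⊕ c · dot (map w is) β
  dot-span {a = a} {b} {c} p≡ [] [] = solve 3 (λ a b c → :0 := a :* :0 :+ b :* :0 :+ c :* :0) refl a b c
  dot-span {u = u} {v} {w} {p} {a} {b} {c} p≡ (i ∷ is) (β ∷ βs) = trans
    (cong₂ (λ s t → s · β ⊕ t) (p≡ i) (dot-span p≡ is βs))
    (solve 10 (λ a b c β x y z d e f →
      (a :* x :+ b :* y :+ c :* z) :* β :+ (a :* d :+ b :* e :+ c :* f)
      := a :* (x :* β :+ d) :+ b :* (y :* β :+ e) :+ c :* (z :* β :+ f)) refl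
      a b c β (u i) (v i) (w i) (dot (map u is) βs) (dot (map v is) βs) (dot (map w is) βs))

  abstract
    -- The coefficients of a relation among four chosen coordinates solve three homogeneous
    -- equations, one for each spanning vector, in four unknowns.
    relation : ∀ u v w (is : Vec (Fin 5) 4) →
      Σ (Vec Carrier 4) λ β → Nontrivial β × (∀ {p} → InSpan u v w p → dot (map p is) β ≡ 𝟘)
    relation u v w is with kernel (map u is ∷ map v is ∷ map w is ∷ [])
    ... | β , β≢0 , (u⊥ VecAll.∷ v⊥ VecAll.∷ w⊥ VecAll.∷ VecAll.[]) = β , β≢0 ,
      λ (a , b , c , p≡) → trans (dot-span p≡ is β)
        (trans (cong₂ _⊕_ (cong₂ _⊕_ (cong (a ·_) u⊥) (cong (b ·_) v⊥)) (cong (c ·_) w⊥))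
          (solve 3 (λ a b c → a :* :0 :+ b :* :0 :+ c :* :0 := :0) refl a b c))

  -- Polynomial functions

  -- Poly n e p: the function p is a polynomial of degree at most n whose
  -- coefficient of xⁿ is e (possibly 𝟘), in Horner form.
  data Poly : ℕ → Carrier → (Carrier → Carrier) → Set where
    constant : ∀ {e p} → (∀ x → p x ≡ e) → Poly 0 e p
    horner : ∀ {n e p r} c → Poly n e r → (∀ x → p x ≡ c ⊕ x · r x) → Poly (suc n) e p

  private variable
    m n : ℕ
    d e : Carrier
    p r : Carrier → Carrier

  Poly-resp : (∀ x → p x ≡ r x) → Poly n e r → Poly n e p
  Poly-resp p≗r (constant r≡e) = constant λ x → trans (p≗r x) (r≡e x)
  Poly-resp p≗r (horner c s r≡) = horner c s λ x → trans (p≗r x) (r≡ x)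

  Poly-suc : Poly n e p → Poly (suc n) 𝟘 p
  Poly-suc (constant {e} p≡e) = horner e (constant λ _ → refl) λ x →
    trans (p≡e x) (solve 2 (λ e x → e := e :+ x :* :0) refl e x)
  Poly-suc (horner c r p≡) = horner c (Poly-suc r) p≡

  Poly-raise : m < n → Poly m e p → Poly n 𝟘 p
  Poly-raise m<n = go (ℕ.≤⇒≤′ m<n)
    where
    go : suc m ≤′ n → Poly m e p → Poly n 𝟘 p
    go ≤′-refl P = Poly-suc P
    go (≤′-step m<n) P = Poly-suc (go m<n P)

  Poly-+ : Poly n d p → Poly n e r → Poly n (d ⊕ e) (λ x → p x ⊕ r x)
  Poly-+ (constant p≡d) (constant r≡e) = constant λ x → cong₂ _⊕_ (p≡d x) (r≡e x)
  Poly-+ (horner {r = s} b P p≡) (horner {r = t} c R r≡) = horner (b ⊕ c) (Poly-+ P R) λ x →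
    trans (cong₂ _⊕_ (p≡ x) (r≡ x))
      (solve 5 (λ b c x s t → (b :+ x :* s) :+ (c :+ x :* t) := (b :+ c) :+ x :* (s :+ t)) refl b c x (s x) (t x))

  Poly-scale : ∀ a → Poly n e p → Poly n (a · e) (λ x → a · p x)
  Poly-scale a (constant p≡e) = constant λ x → cong (a ·_) (p≡e x)
  Poly-scale a (horner {r = r} c R p≡) = horner (a · c) (Poly-scale a R) λ x →
    trans (cong (a ·_) (p≡ x))
      (solve 4 (λ a c x r → a :* (c :+ x :* r) := a :* c :+ x :* (a :* r)) refl a c x (r x))

  Poly-* : Poly m d p → Poly n e r → Poly (m + n) (d · e) (λ x → p x · r x)
  Poly-* (constant {d} p≡d) R = Poly-resp (λ x → cong (_· _) (p≡d x)) (Poly-scale d R)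
  Poly-* {m = suc m} {d = d} {n = n} {e = e} {r = r} (horner {r = s} c S p≡) R =
    -- The summand `c · r x` has lower degree and contributes `𝟘` to the leading coefficient.
    subst (λ t → Poly _ t _) (+-identityˡ (d · e))
      (Poly-resp
        (λ x → trans (cong (_· r x) (p≡ x))
          (solve 4 (λ c x s r → (c :+ x :* s) :* r := c :* r :+ (:0 :+ x :* (s :* r))) refl c x (s x) (r x)))
        (Poly-+ (Poly-raise (s≤s (ℕ.m≤n+m n m)) (Poly-scale c R)) (horner 𝟘 (Poly-* S R) λ _ → refl)))

  -- Synthetic division: if `p = c + x t` and `t = t(s) + (x - s) t′`, the quotient is
  -- `t(s) + x t′`. It keeps the leading coefficient `e`, so a nonzero one survives repeated
  -- division.
  divide : Poly (suc n) e p → ∀ s →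
    Σ (Carrier → Carrier) λ r → Poly n e r × (∀ x → p x ≡ p s ⊕ (x ⊕ ⊖ s) · r x)
  divide {n = zero} {e} {p} (horner {r = t} c (constant t≡e) p≡) s = (λ _ → e) , constant (λ _ → refl) , λ x →
    trans (at x) (trans
      (solve 4 (λ c x s e → c :+ x :* e := (c :+ s :* e) :+ (x :- s) :* e) refl c x s e)
      (cong (_⊕ (x ⊕ ⊖ s) · e) (sym (at s))))
    where
    at : ∀ x → p x ≡ c ⊕ x · e
    at x = trans (p≡ x) (cong (λ t → c ⊕ x · t) (t≡e x))
  divide {n = suc n} (horner {r = t} c T p≡) s with divide T s
  ... | t′ , T′ , t≡ = (λ x → t s ⊕ x · t′ x) , horner (t s) T′ (λ _ → refl) , λ x →
    trans (p≡ x) (trans (cong (λ y → c ⊕ x · y) (t≡ x)) (trans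
      (solve 5 (λ c x s ts t′ → c :+ x :* (ts :+ (x :- s) :* t′) := (c :+ s :* ts) :+ (x :- s) :* (ts :+ x :* t′)) refl c x s (t s) (t′ x))
      (cong (_⊕ (x ⊕ ⊖ s) · (t s ⊕ x · t′ x)) (sym (p≡ s)))))

  divide-root : Poly (suc n) e p → ∀ s → p s ≡ 𝟘 →
    Σ (Carrier → Carrier) λ r → Poly n e r × (∀ x → p x ≡ (x ⊕ ⊖ s) · r x)
  divide-root P s ps≡0 = let r , R , p≡ = divide P s in
    r , R , λ x → trans (p≡ x) (trans (cong (_⊕ (x ⊕ ⊖ s) · r x) ps≡0) (+-identityˡ _))

  x-s≢0 : ∀ {x s} → x ≢ s → x ⊕ ⊖ s ≢ 𝟘
  x-s≢0 {x} {s} x≢s = x≢s ∘ x∙y⁻¹≈ε⇒x≈y x s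

  -- Divide by `x - s` for the first root `s`; the other roots differ from `s`, hence are roots of
  -- the quotient.
  roots≤degree : e ≢ 𝟘 → Poly n e p → ∀ {xs} → Unique xs → All (λ x → p x ≡ 𝟘) xs → length xs ≤ n
  roots≤degree e≢0 P [] [] = z≤n
  roots≤degree e≢0 (constant p≡e) (_ ∷ _) (px≡0 ∷ _) = ⊥-elim (e≢0 (trans (sym (p≡e _)) px≡0))
  roots≤degree e≢0 P@(horner _ _ _) {s ∷ xs} (s∉xs ∷ xs!) (ps≡0 ∷ pxs≡0) =
    let r , R , p≡ = divide-root P s ps≡0 in
    s≤s (roots≤degree e≢0 R xs! (All.zipWith
      (λ {x} (s≢x , px≡0) → ·-cancel-0 (x-s≢0 (s≢x ∘ sym)) (trans (sym (p≡ x)) px≡0)) (s∉xs , pxs≡0)))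

  -- Polynomials of exact, strictly decreasing degrees below `n`; no cancellation of leading terms
  -- can occur in a combination.
  data Echelon : ℕ → ∀ {k} → Vec (Carrier → Carrier) k → Set where
    [] : Echelon n []
    step : ∀ {k} {gs : Vec (Carrier → Carrier) k} →
      m < n → e ≢ 𝟘 → Poly m e p → Echelon m gs → Echelon n (p ∷ gs)

  combination : ∀ {k} → Vec (Carrier → Carrier) k → Vec Carrier k → Carrier → Carrier
  combination gs β x = dot (map (_$ x) gs) β

  Poly-𝟘 : ∀ n → Poly n 𝟘 (λ _ → 𝟘)
  Poly-𝟘 zero = constant λ _ → refl
  Poly-𝟘 (suc n) = Poly-suc (Poly-𝟘 n)

  echelon-degree : ∀ {k} {gs : Vec _ k} → Echelon n gs → ∀ β → Poly n 𝟘 (combination gs β)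
  -- The functions `gs` have degrees below `m`, so they add only the `𝟘` to the top coefficient.
  echelon-top : ∀ {k} {gs : Vec _ k} → Poly m e p → Echelon m gs → ∀ b β →
    Poly m (b · e ⊕ 𝟘) (combination (p ∷ gs) (b ∷ β))

  echelon-degree [] [] = Poly-𝟘 _
  echelon-degree (step m<n _ P gs) (b ∷ β) = Poly-raise m<n (echelon-top P gs b β)

  echelon-top {p = p} {gs = gs} P E b β =
    Poly-resp (λ x → cong (_⊕ combination gs β x) (*-comm (p x) b)) (Poly-+ (Poly-scale b P) (echelon-degree E β))

  -- The first nonzero entry of `β` fixes the degree of the combination, which is therefore a
  -- nonzero polynomial of degree below `n`.
  echelon-roots : ∀ {k} {gs : Vec _ k} {β} → Echelon n gs → Nontrivial β →
    ∀ {xs} → Unique xs → All (λ x → combination gs β x ≡ 𝟘) xs → length xs < n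
  echelon-roots {β = b ∷ β} (step {p = p} m<n e≢0 P gs) β≢0 xs! roots with b ≟ 𝟘
  ... | no b≢0 = ℕ.≤-<-trans
    (roots≤degree (subst (_≢ 𝟘) (sym (+-identityʳ _)) (·-nonzero b≢0 e≢0)) (echelon-top P gs b β) xs! roots) m<n
  ... | yes refl with β≢0
  ...   | here 0≢0 = ⊥-elim (0≢0 refl)
  ...   | there β≢0 = ℕ.<-trans (echelon-roots gs β≢0 xs! (All.map (drop-term refl) roots)) m<n

  -- Intersections with a hyperelliptic curve

  module Curve {P : Carrier → Carrier} {π : Carrier} (π≢0 : π ≢ 𝟘) (P-poly : Poly 3 π P) (c : Carrier) where

    OnCurve : Carrier × Carrier → Set
    OnCurve (x , y) = y · y ≡ P x ⊕ c · y

    -- Over a fixed `s`, the ordinate is a root of the monic quadratic `y² - c y - P s`.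
    fibre≤2 : ∀ {s zs} → Unique zs → All OnCurve zs → All (λ z → proj₁ z ≡ s) zs → length zs ≤ 2
    fibre≤2 {s} {zs} zs! on ≡s = subst (_≤ 2) (List.length-map proj₂ zs)
      (roots≤degree (𝟘≢𝟙 ∘ sym) quadratic
        (unique-map proj₂ (λ { refl refl refl → refl }) zs! ≡s)
        (All.map⁺ (All.zipWith (λ { {x , y} (on , refl) → root y (P x) on }) (on , ≡s))))
      where
      quadratic : Poly 2 𝟙 (λ y → ⊖ P s ⊕ y · (⊖ c ⊕ y · 𝟙))
      quadratic = horner _ (horner _ (constant λ _ → refl) λ _ → refl) λ _ → refl
      root : ∀ y v → y · y ≡ v ⊕ c · y → ⊖ v ⊕ y · (⊖ c ⊕ y · 𝟙) ≡ 𝟘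
      root y v eq = trans
        (solve 3 (λ y v c → :- v :+ y :* (:- c :+ y :* :1) := y :* y :- (v :+ c :* y)) refl y v c)
        (x≈y⇒x∙y⁻¹≈ε eq)

    -- The norm of A y − B from the function field of the curve; the term P A²
    -- dominates because P has odd degree.
    norm-poly : ∀ {α β A B} → Poly m α A → Poly (suc m) β B →
      Poly (3 + (m + m)) (π · (α · α) ⊕ 𝟘 ⊕ 𝟘)
        (λ x → P x · (A x · A x) ⊕ c · (A x · B x) ⊕ (⊖ 𝟙) · (B x · B x))
    norm-poly {m = m} A B = Poly-+ (Poly-+ (Poly-* P-poly (Poly-* A A))
      (Poly-raise (s≤s (subst (_≤ 2 + (m + m)) (sym (ℕ.+-suc m m)) (ℕ.n≤1+n _))) (Poly-scale c (Poly-* A B))))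
      (Poly-raise (s≤s (s≤s (ℕ.≤-reflexive (ℕ.+-suc m m)))) (Poly-scale (⊖ 𝟙) (Poly-* B B)))

    -- Substituting `b = a y` turns the norm into `-a² (y² - P x - c y)`.
    norm-root : ∀ {x y a b} → OnCurve (x , y) → a · y ≡ b →
      P x · (a · a) ⊕ c · (a · b) ⊕ (⊖ 𝟙) · (b · b) ≡ 𝟘
    norm-root {x} {y} {a} on refl = trans
      (solve 4 (λ v c a y → v :* (a :* a) :+ c :* (a :* (a :* y)) :+ (:- :1) :* ((a :* y) :* (a :* y))
        := (:- (a :* a)) :* (y :* y :- (v :+ c :* y))) refl (P x) c a y)
      (trans (cong ((⊖ (a · a)) ·_) (x≈y⇒x∙y⁻¹≈ε on)) (zeroʳ _))

    -- Induction on `m`. If `A` vanishes at no listed point, then `x` determines `y` and is a root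
    -- of the norm, of exact degree `2m + 3`. Otherwise a linear factor common to `A` and `B` is
    -- removed.
    intersection≤ : ∀ m {α β A B} → α ≢ 𝟘 → Poly m α A → Poly (suc m) β B →
      ∀ {zs} → Unique zs → All OnCurve zs → All (λ z → A (proj₁ z) · proj₂ z ≡ B (proj₁ z)) zs →
      length zs ≤ 3 + (m + m)
    intersection≤ m {α} {A = A} {B} α≢0 A-poly B-poly {zs} zs! on Ay≡B with ListAny.any? (λ z → A (proj₁ z) ≟ 𝟘) zs
    ... | no A≢0 = subst (_≤ 3 + (m + m)) (List.length-map proj₁ zs)
      (roots≤degree
        (subst (_≢ 𝟘) (solve 1 (λ t → t := t :+ :0 :+ :0) refl (π · (α · α))) (·-nonzero π≢0 (·-nonzero α≢0 α≢0)))
        (norm-poly A-poly B-poly)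
        (unique-map proj₁ (λ { {x , _} (Ax≢0 , e) (_ , e′) refl → cong (x ,_) (·-cancelˡ Ax≢0 (trans e (sym e′))) })
          zs! (All.zip (All.¬Any⇒All¬ zs A≢0 , Ay≡B)))
        (All.map⁺ (All.zipWith (λ (on , e) → norm-root on e) (on , Ay≡B))))
    intersection≤ zero α≢0 (constant A≡α) _ _ _ _ | yes Ax≡0 =
      ⊥-elim (α≢0 (trans (sym (A≡α _)) (proj₂ (ListAny.satisfied Ax≡0))))
    -- At a common root s of A and B both points of the fibre over s may occur,
    -- but dividing A and B by x − s lowers the bound by two.
    intersection≤ (suc m) {A = A} {B} α≢0 A-poly B-poly {zs} zs! on Ay≡B | yes Ax≡0 =
      subst₂ _≤_ (sym (length-filter-split fibre? zs)) (cong (4 +_) (sym (ℕ.+-suc m m)))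
        (ℕ.+-mono-≤
          (fibre≤2 (Unique.filter⁺ fibre? zs!) (All.filter⁺ fibre? on) (All.all-filter fibre? zs))
          (intersection≤ m α≢0 A′-poly B′-poly (Unique.filter⁺ off? zs!) (All.filter⁺ off? on)
            (All.zipWith (λ (s≢x , e) → cancel s≢x e) (All.all-filter off? zs , All.filter⁺ off? Ay≡B))))
      where
      -- At a listed point with `A x = 0`, the equation `A x · y = B x` forces `B x = 0`.
      common : Σ Carrier λ s → A s ≡ 𝟘 × B s ≡ 𝟘
      common = let (_ , y) = ListAny.lookup Ax≡0 ; e , As≡0 = All.lookupAny Ay≡B Ax≡0 in _ , As≡0 , trans (sym e) (trans (cong (_· y) As≡0) (zeroˡ y))
      s = proj₁ common
      fibre? : Decidable (λ (z : Carrier × Carrier) → proj₁ z ≡ s)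
      fibre? z = proj₁ z ≟ s
      off? = ¬? ∘ fibre?
      A/ = divide-root A-poly s (proj₁ (proj₂ common))
      B/ = divide-root B-poly s (proj₂ (proj₂ common))
      A′-poly = proj₁ (proj₂ A/)
      B′-poly = proj₁ (proj₂ B/)
      cancel : ∀ {x y} → x ≢ s → A x · y ≡ B x → proj₁ A/ x · y ≡ proj₁ B/ x
      cancel {x} {y} x≢s e = ·-cancelˡ (x-s≢0 x≢s) (trans
        (solve 3 (λ d a y → d :* (a :* y) := d :* a :* y) refl (x ⊕ ⊖ s) (proj₁ A/ x) y)
        (trans (cong (_· y) (sym (proj₂ (proj₂ A/) x))) (trans e (proj₂ (proj₂ B/) x))))

  -- The surface

  surface : Carrier × Carrier → V
  surface (x , y) 0F = 𝟙
  surface (x , y) 1F = x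
  surface (x , y) 2F = y
  surface (x , y) 3F = x · x · x ⊕ y · y
  surface (x , y) 4F = x · x · x · x ⊕ y · y · y

  surface-injective : ∀ {z z′} → SamePoint (surface z) (surface z′) → z ≡ z′
  surface-injective {x , y} {x′ , y′} (c , eq) = cong₂ _,_ (coordinate (eq 1F)) (coordinate (eq 2F))
    where
    coordinate : ∀ {t t′} → t ≡ c · t′ → t ≡ t′
    coordinate {t′ = t′} t≡ct′ = trans t≡ct′
      -- Both first coordinates are `𝟙`, so the scalar `c` is `𝟙`.
      (trans (cong (_· t′) (trans (sym (*-identityʳ c)) (sym (eq 0F)))) (*-identityˡ t′))

  eliminate : ∀ {c i y r} → c · i ≡ 𝟙 → y · c ⊕ r ≡ 𝟘 → y ≡ (⊖ i) · r
  eliminate {c} {i} {y} {r} ci≡1 yc+r≡0 = begin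
    y                                       ≡⟨ solve 4 (λ c i y r → y := (:1 :- c :* i) :* y :+ i :* (y :* c :+ r) :+ (:- i) :* r) refl c i y r ⟩
    (𝟙 ⊕ ⊖ (c · i)) · y ⊕ i · (y · c ⊕ r) ⊕ (⊖ i) · r ≡⟨ cong₂ (λ s t → (𝟙 ⊕ ⊖ s) · y ⊕ i · t ⊕ (⊖ i) · r) ci≡1 yc+r≡0 ⟩
    (𝟙 ⊕ ⊖ 𝟙) · y ⊕ i · 𝟘 ⊕ (⊖ i) · r       ≡⟨ solve 3 (λ i y r → (:1 :- :1) :* y :+ i :* :0 :+ (:- i) :* r := (:- i) :* r) refl i y r ⟩
    (⊖ i) · r                               ∎
    where open ≡-Reasoning

  Nontrivial-tail : ∀ {b} {β : Vec Carrier n} → b ≡ 𝟘 → Nontrivial (b ∷ β) → Nontrivial β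
  Nontrivial-tail b≡0 (here b≢0) = ⊥-elim (b≢0 b≡0)
  Nontrivial-tail b≡0 (there β≢0) = β≢0

  VanishesAt : Vec (Fin 5) n → Vec Carrier n → Carrier × Carrier → Set
  VanishesAt is β z = dot (map (surface z) is) β ≡ 𝟘

  -- Plane sections of the surface.

  module Section (u v w : V) {zs : List (Carrier × Carrier)} (zs! : Unique zs)
                 (inPlane : All (InSpan u v w ∘ surface) zs) where

    -- On the line `y = s + t x` the coordinates g, f, x, 1 become monic polynomials in `x` of
    -- degrees 4, 3, 1, 0 in every characteristic. The coordinate y is left out, being a combination
    -- of 1 and x there.
    graph≤4 : ∀ s t → All (λ z → proj₂ z ≡ s ⊕ t · proj₁ z) zs → length zs ≤ 4
    graph≤4 s t onLine with relation u v w (4F ∷ 3F ∷ 1F ∷ 0F ∷ [])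
    ... | β , β≢0 , vanish = ℕ.≤-pred (subst (_< 5) (List.length-map proj₁ zs)
      (echelon-roots {β = β} echelon β≢0
        (unique-map proj₁ (λ { refl refl refl → refl }) zs! onLine)
        (All.map⁺ (All.zipWith (λ { (z∈ , refl) → vanish z∈ }) (inPlane , onLine)))))
      where
      echelon : Echelon 5
        ( (λ x → x · x · x · x ⊕ (s ⊕ t · x) · (s ⊕ t · x) · (s ⊕ t · x))
        ∷ (λ x → x · x · x ⊕ (s ⊕ t · x) · (s ⊕ t · x))
        ∷ (λ x → x)
        ∷ (λ _ → 𝟙) ∷ [])
      echelon = step ℕ.≤-refl (𝟘≢𝟙 ∘ sym)
          (horner (s · s · s) (horner (s · s · t ⊕ s · s · t ⊕ s · s · t) (horner (s · t · t ⊕ s · t · t ⊕ s · t · t)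
            (horner (t · t · t) (constant λ _ → refl) λ _ → refl) λ _ → refl) λ _ → refl)
            λ x → solve 3 (λ x s t → x :* x :* x :* x :+ (s :+ t :* x) :* (s :+ t :* x) :* (s :+ t :* x)
              := s :* s :* s :+ x :* ((s :* s :* t :+ s :* s :* t :+ s :* s :* t) :+ x :* ((s :* t :* t :+ s :* t :* t :+ s :* t :* t)
                 :+ x :* (t :* t :* t :+ x :* :1)))) refl x s t)
        (step ℕ.≤-refl (𝟘≢𝟙 ∘ sym)
          (horner (s · s) (horner (s · t ⊕ s · t) (horner (t · t) (constant λ _ → refl) λ _ → refl) λ _ → refl)
            λ x → solve 3 (λ x s t → x :* x :* x :+ (s :+ t :* x) :* (s :+ t :* x)
              := s :* s :+ x :* ((s :* t :+ s :* t) :+ x :* (t :* t :+ x :* :1))) refl x s t)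
        (step (s≤s (s≤s z≤n)) (𝟘≢𝟙 ∘ sym)
          (horner 𝟘 (constant λ _ → refl) λ x → solve 1 (λ x → x := :0 :+ x :* :1) refl x)
        (step ℕ.≤-refl (𝟘≢𝟙 ∘ sym) (constant λ _ → refl) [])))

    -- With `x = s` constant, the coordinates g, f, y, 1 are monic in `y` of degrees 3, 2, 1, 0.
    vertical≤3 : ∀ s → All (λ z → proj₁ z ≡ s) zs → length zs ≤ 3
    vertical≤3 s onLine with relation u v w (4F ∷ 3F ∷ 2F ∷ 0F ∷ [])
    ... | β , β≢0 , vanish = ℕ.≤-pred (subst (_< 4) (List.length-map proj₂ zs)
      (echelon-roots {β = β} echelon β≢0
        (unique-map proj₂ (λ { refl refl refl → refl }) zs! onLine)
        (All.map⁺ (All.zipWith (λ { (z∈ , refl) → vanish z∈ }) (inPlane , onLine)))))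
      where
      echelon : Echelon 4
        ( (λ y → s · s · s · s ⊕ y · y · y)
        ∷ (λ y → s · s · s ⊕ y · y)
        ∷ (λ y → y)
        ∷ (λ _ → 𝟙) ∷ [])
      echelon = step ℕ.≤-refl (𝟘≢𝟙 ∘ sym)
          (horner (s · s · s · s) (horner 𝟘 (horner 𝟘 (constant λ _ → refl) λ _ → refl) λ _ → refl)
            λ y → solve 2 (λ y k → k :+ y :* y :* y := k :+ y :* (:0 :+ y :* (:0 :+ y :* :1))) refl y (s · s · s · s))
        (step ℕ.≤-refl (𝟘≢𝟙 ∘ sym)
          (horner (s · s · s) (horner 𝟘 (constant λ _ → refl) λ _ → refl)
            λ y → solve 2 (λ y k → k :+ y :* y := k :+ y :* (:0 :+ y :* :1)) refl y (s · s · s))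
        (step ℕ.≤-refl (𝟘≢𝟙 ∘ sym)
          (horner 𝟘 (constant λ _ → refl) λ x → solve 1 (λ x → x := :0 :+ x :* :1) refl x)
        (step ℕ.≤-refl (𝟘≢𝟙 ∘ sym) (constant λ _ → refl) [])))

    line≤4 : ∀ γ → Nontrivial γ → All (VanishesAt (2F ∷ 1F ∷ 0F ∷ []) γ) zs → length zs ≤ 4
    line≤4 (c₂ ∷ c₁ ∷ c₀ ∷ []) γ≢0 rel with c₂ ≟ 𝟘
    ... | no c₂≢0 = let i , c₂i≡1 = inverse c₂ c₂≢0 in
      graph≤4 ((⊖ i) · c₀) ((⊖ i) · c₁) (All.map (λ { {x , y} eq → trans (eliminate c₂i≡1 eq)
        (solve 4 (λ j x c₁ c₀ → j :* (x :* c₁ :+ (:1 :* c₀ :+ :0)) := j :* c₀ :+ j :* c₁ :* x) refl (⊖ i) x c₁ c₀) }) rel)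
    ... | yes c₂≡0 with c₁ ≟ 𝟘
    ...   | no c₁≢0 = let i , c₁i≡1 = inverse c₁ c₁≢0 in
      ℕ.m≤n⇒m≤1+n (vertical≤3 ((⊖ i) · (𝟙 · c₀ ⊕ 𝟘)) (All.map (λ eq → eliminate c₁i≡1 (drop-term c₂≡0 eq)) rel))
    ...   | yes c₁≡0 with Nontrivial-tail c₁≡0 (Nontrivial-tail c₂≡0 γ≢0)
    -- The relation reads `c₀ = 0` with `c₀` nonzero, so there is no point at all.
    ...     | here c₀≢0 with rel
    ...       | [] = z≤n
    ...       | eq ∷ _ = ⊥-elim (c₀≢0 (trans (solve 1 (λ c → c := :1 :* c :+ :0) refl c₀) (drop-term c₁≡0 (drop-term c₂≡0 eq))))

    affine-form : ∀ {j x y c₂ c₁ c₀} →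
      j · (y · c₂ ⊕ (x · c₁ ⊕ (𝟙 · c₀ ⊕ 𝟘))) ≡ j · c₀ ⊕ j · c₁ · x ⊕ j · c₂ · y
    affine-form {j} {x} {y} {c₂} {c₁} {c₀} = solve 6 (λ j x y c₂ c₁ c₀ →
      j :* (y :* c₂ :+ (x :* c₁ :+ (:1 :* c₀ :+ :0))) := j :* c₀ :+ j :* c₁ :* x :+ j :* c₂ :* y) refl j x y c₂ c₁ c₀

    curves≤9 : ∀ a b c a′ b′ c′ →
      All (λ z → surface z 3F ≡ a ⊕ b · proj₁ z ⊕ c · proj₂ z) zs →
      All (λ z → surface z 4F ≡ a′ ⊕ b′ · proj₁ z ⊕ c′ · proj₂ z) zs →
      length zs ≤ 9
    -- With `A` of degree 3 the bound is 3 + (3 + 3) = 9.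
    curves≤9 a b c a′ b′ c′ f≡ g≡ = intersection≤ 3 (𝟘≢𝟙 ∘ sym) A-poly B-poly zs!
      (All.map (λ {z} → cubic z) f≡) (All.zipWith (λ {z} (f≡ , g≡) → linear z f≡ g≡) (f≡ , g≡))
      where
      P A B : Carrier → Carrier
      P x = a ⊕ x · (b ⊕ x · (𝟘 ⊕ x · (⊖ 𝟙)))
      -- On the cubic, `y³ = (P + c²) y + c P`. Inserting this in the equation for g gives
      -- `A = c′ - c² - P` and `B = x⁴ + c P - a′ - b′ x`.
      A x = (c′ ⊕ ⊖ a ⊕ ⊖ (c · c)) ⊕ x · (⊖ b ⊕ x · (𝟘 ⊕ x · 𝟙))
      B x = (c · a ⊕ ⊖ a′) ⊕ x · ((c · b ⊕ ⊖ b′) ⊕ x · (𝟘 ⊕ x · (⊖ c ⊕ x · 𝟙)))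

      P-poly : Poly 3 (⊖ 𝟙) P
      P-poly = horner _ (horner _ (horner _ (constant λ _ → refl) λ _ → refl) λ _ → refl) λ _ → refl
      A-poly : Poly 3 𝟙 A
      A-poly = horner _ (horner _ (horner _ (constant λ _ → refl) λ _ → refl) λ _ → refl) λ _ → refl
      B-poly : Poly 4 𝟙 B
      B-poly = horner _ (horner _ (horner _ (horner _ (constant λ _ → refl) λ _ → refl) λ _ → refl) λ _ → refl) λ _ → refl

      -1≢0 : ⊖ 𝟙 ≢ 𝟘
      -1≢0 -1≡0 = 𝟘≢𝟙 (trans (sym (zeroˡ (⊖ 𝟙))) (trans (cong (_· (⊖ 𝟙)) (sym -1≡0)) (solve 0 ((:- :1) :* (:- :1) := :1) refl)))

      open Curve -1≢0 P-poly c

      cubic : ∀ z → surface z 3F ≡ a ⊕ b · proj₁ z ⊕ c · proj₂ z → OnCurve z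
      cubic (x , y) f≡ = trans
        (solve 2 (λ x y → y :* y := (x :* x :* x :+ y :* y) :- x :* x :* x) refl x y)
        (trans (cong (_⊕ ⊖ (x · x · x)) f≡)
          (solve 5 (λ a b c x y → (a :+ b :* x :+ c :* y) :- x :* x :* x
            := (a :+ x :* (b :+ x :* (:0 :+ x :* (:- :1)))) :+ c :* y) refl a b c x y))

      -- A y − B = (y + c) (f − a − b x − c y) − (g − a′ − b′ x − c′ y)
      linear : ∀ z → surface z 3F ≡ a ⊕ b · proj₁ z ⊕ c · proj₂ z →
        surface z 4F ≡ a′ ⊕ b′ · proj₁ z ⊕ c′ · proj₂ z → A (proj₁ z) · proj₂ z ≡ B (proj₁ z)
      linear (x , y) f≡ g≡ = x∙y⁻¹≈ε⇒x≈y _ _ (trans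
        (solve 8 (λ a b c a′ b′ c′ x y →
          ((c′ :- a :- c :* c) :+ x :* (:- b :+ x :* (:0 :+ x :* :1))) :* y
            :- ((c :* a :- a′) :+ x :* ((c :* b :- b′) :+ x :* (:0 :+ x :* (:- c :+ x :* :1))))
          := (y :+ c) :* ((x :* x :* x :+ y :* y) :- (a :+ b :* x :+ c :* y))
            :- ((x :* x :* x :* x :+ y :* y :* y) :- (a′ :+ b′ :* x :+ c′ :* y))) refl a b c a′ b′ c′ x y)
        (trans (cong₂ (λ s t → (y ⊕ c) · s ⊕ ⊖ t) (x≈y⇒x∙y⁻¹≈ε f≡) (x≈y⇒x∙y⁻¹≈ε g≡))
          (solve 1 (λ y → y :* :0 :- :0 := :0) refl (y ⊕ c))))

    section≤9 : length zs ≤ 9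
    section≤9 with relation u v w (3F ∷ 2F ∷ 1F ∷ 0F ∷ []) | relation u v w (4F ∷ 2F ∷ 1F ∷ 0F ∷ [])
    ... | (b ∷ β) , β≢0 , f-rel | (d ∷ δ) , δ≢0 , g-rel with b ≟ 𝟘 | d ≟ 𝟘
    -- Without its f or g term, a relation is a nontrivial one among y, x, 1 alone.
    ... | yes b≡0 | _ = ℕ.≤-trans
      (line≤4 β (Nontrivial-tail b≡0 β≢0) (All.map (λ z∈ → drop-term b≡0 (f-rel z∈)) inPlane)) (ℕ.m≤n+m 4 5)
    ... | no _ | yes d≡0 = ℕ.≤-trans
      (line≤4 δ (Nontrivial-tail d≡0 δ≢0) (All.map (λ z∈ → drop-term d≡0 (g-rel z∈)) inPlane)) (ℕ.m≤n+m 4 5)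
    section≤9 | (b ∷ b₂ ∷ b₁ ∷ b₀ ∷ []) , _ , f-rel | (d ∷ d₂ ∷ d₁ ∷ d₀ ∷ []) , _ , g-rel | no b≢0 | no d≢0 =
      let i , bi≡1 = inverse b b≢0
          j , dj≡1 = inverse d d≢0
      in curves≤9 ((⊖ i) · b₀) ((⊖ i) · b₁) ((⊖ i) · b₂) ((⊖ j) · d₀) ((⊖ j) · d₁) ((⊖ j) · d₂)
        (All.map (λ z∈ → trans (eliminate bi≡1 (f-rel z∈)) affine-form) inPlane)
        (All.map (λ z∈ → trans (eliminate dj≡1 (g-rel z∈)) affine-form) inPlane)

  -- The point set and its size.

  parameter : Fin (q * q) → Carrier × Carrier
  parameter i = let j , k = remQuot {q} q i in Inverse.to enumeration j , Inverse.to enumeration k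

  parameter-injective : ∀ {i j} → parameter i ≡ parameter j → i ≡ j
  parameter-injective {i} {j} eq = begin
    i                                      ≡⟨ Fin.combine-remQuot {q} q i ⟨
    uncurry combine (remQuot {q} q i)      ≡⟨ cong₂ combine (to-injective (cong proj₁ eq)) (to-injective (cong proj₂ eq)) ⟩
    uncurry combine (remQuot {q} q j)      ≡⟨ Fin.combine-remQuot {q} q j ⟩
    j                                      ∎
    where
    open ≡-Reasoning
    to-injective = Injection.injective (Inverse⇒Injection enumeration)

  surface-points : PointSet (q * q)
  surface-points = record
    { pt = surface ∘ parameter
    ; nonzero = λ _ all≡0 → 𝟘≢𝟙 (sym (all≡0 0F))
    ; distinct = λ _ _ → parameter-injective ∘ surface-injective
    }

  surface-is92 : Is92Set surface-points
  -- Ten distinct parameters in one plane would give 10 ≤ 9, that is 9 < 9.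
  surface-is92 u v w _ (f , f-injective , f∈span) = ℕ.<-irrefl refl
    (Section.section≤9 u v w
      (Unique.tabulate⁺ {f = parameter ∘ f} (λ {i} {j} eq → f-injective i j (parameter-injective eq)))
      (All.tabulate⁺ {f = parameter ∘ f} f∈span))

-- The two inequalities express that `n / q²` differs from 1 by at most `1 / (k + 1)`, which encodes
-- 1 + o(1). Since `n` is exactly `q²`, the threshold `Q = 0` serves for every `k`.
theorem14 : ∀ (k : ℕ) → Σ ℕ λ Q → ∀ (q : ℕ) → Q ≤ q → (F : FiniteField q) →
    Σ ℕ λ n → Σ (PG4.PointSet F n) λ X →
    PG4.Is92Set F X × (k * q ^ 2 ≤ (k + 1) * n) × ((k + 1) * n ≤ (k + 2) * q ^ 2)
theorem14 k = 0 , λ q _ F → q * q , OverField.surface-points F , OverField.surface-is92 F ,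
  ℕ.*-mono-≤ (ℕ.m≤m+n k 1) (ℕ.≤-reflexive (q^2≡q*q q)) ,
  ℕ.*-mono-≤ (ℕ.+-monoʳ-≤ k (ℕ.n≤1+n 1)) (ℕ.≤-reflexive (sym (q^2≡q*q q)))
  where
  q^2≡q*q : ∀ q → q ^ 2 ≡ q * q
  q^2≡q*q q = cong (q *_) (ℕ.*-identityʳ q)
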